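{- Let $q$ be a prime power, $k=\mathbb{F}_q$, $n\ge 1$ an integer, and $h\in k^*$. Then $$N_0=\frac{q^{\binom{n}{2}}(q-1)}{q}\left((-1)^n+\prod_{i=2}^{n}(q^i-1)\right),$$ $$N_h=\frac{q^{\binom{n}{2}}(q-1)}{q}\left(\frac{(-1)^{n-1}}{q-1}+\prod_{i=2}^{n}(q^i-1)\right).$$
   Context: For $\beta\in k$, $N_\beta=\#\{X\in \mathrm{GL}_n(k) : \operatorname{tr} X=\beta\}$ is the number of invertible $n\times n$ matrices over $k$ with trace $\beta$. Empty products equal $1$. -}

module Defs where

open import Algebra.Apartness.Bundles using (HeytingField; HeytingCommutativeRing)
open import Algebra.Bundles using (CommutativeRing)
import Algebra.Definitions as AlgebraDefinitions
import Algebra.Definitions.RawMonoid as RawMonoidDefinitions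
open import Data.Bool.Base using (if_then_else_)
open import Data.Fin.Base using (Fin)
import Data.Fin.Properties as Fin
open import Data.List.Base using (applyUpTo)
open import Data.Nat.Base hiding (_⊔_)
open import Data.Nat.ListAction using (product)
open import Data.Nat.Primality using (Prime; prime⇒nonTrivial)
open import Data.Nat.Properties
  using (<-≤-trans; <-trans; m≤m*n; m^n≢0; m<n⇒0<n∸m)
open import Data.Product.Base using (_×_; proj₁)
open import Data.Vec.Functional using (Vector)
import Data.Vec.Functional.Relation.Binary.Equality.Setoid as VectorEquality
open import Function.Bundles using (Inverse)
open import Level using (Level; _⊔_)
open import Relation.Binary.Bundles using (Setoid)
import Relation.Binary.Construct.On as On
open import Relation.Binary.PropositionalEquality as ≡ using (_≡_)
open import Relation.Nullary.Decidable.Core using (does)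

private
  variable
    c ℓ ℓ₁ ℓ₂ : Level

record IsPrimePower (q : ℕ) : Set where
  field
    base     : ℕ
    exponent : ℕ
    isPrime  : Prime base
    positive : exponent ≥ 1
    equation : q ≡ base ^ exponent

primePower>1 : ∀ {q} → IsPrimePower q → 1 < q
primePower>1 record { base = p ; exponent = suc m ; isPrime = p-prime ; equation = ≡.refl } =
  <-≤-trans 1<p (m≤m*n p (p ^ m) {{m^n≢0 p m {{>-nonZero (<-trans z<s 1<p)}}}})
  where
  1<p : 1 < p
  1<p = nonTrivial⇒n>1 p {{prime⇒nonTrivial p-prime}}

-- Opening this module lets q and q ∸ 1 be used as denominators.
module Denominators {q : ℕ} (pp : IsPrimePower q) where
  instance
    q-nonZero : NonZero q
    q-nonZero = >-nonZero (<-trans z<s (primePower>1 pp))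

    q∸1-nonZero : NonZero (q ∸ 1)
    q∸1-nonZero = >-nonZero (m<n⇒0<n∸m (primePower>1 pp))

-- The product of f i over a ≤ i ≤ b; it is 1 when b < a.
∏-range : ℕ → ℕ → (ℕ → ℕ) → ℕ
∏-range a b f = product (applyUpTo (λ j → f (a + j)) (suc b ∸ a))

infix 10 ∏-range
syntax ∏-range a b (λ i → x) = ∏[ i from a to b ] x

-- Elements are counted up to the equality of the setoid.
HasCardinality : Setoid c ℓ → ℕ → Set (c ⊔ ℓ)
HasCardinality S N = Inverse S (≡.setoid (Fin N))

module Matrices (R : CommutativeRing c ℓ) where
  open CommutativeRing R
    using (Carrier; _≈_; 0#; 1#; setoid; +-rawMonoid)
    renaming (_*_ to _·_)
  open RawMonoidDefinitions +-rawMonoid using (sum)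

  SquareMatrix : ℕ → Set c
  SquareMatrix n = Vector (Vector Carrier n) n

  matrixSetoid : ℕ → Setoid c ℓ
  matrixSetoid n = VectorEquality.≋-setoid (VectorEquality.≋-setoid setoid n) n

  identityMatrix : ∀ {n} → SquareMatrix n
  identityMatrix i j = if does (i Fin.≟ j) then 1# else 0#

  infixl 7 _⊗_
  _⊗_ : ∀ {n} → SquareMatrix n → SquareMatrix n → SquareMatrix n
  (X ⊗ Y) i j = sum (λ l → X i l · Y l j)

  tr : ∀ {n} → SquareMatrix n → Carrier
  tr X = sum (λ i → X i i)

  IsInvertible : ∀ {n} → SquareMatrix n → Set (c ⊔ ℓ)
  IsInvertible {n} =
    AlgebraDefinitions.Invertible (Setoid._≈_ (matrixSetoid n)) identityMatrix _⊗_

  -- {X ∈ GLₙ(R) : tr X = β}; elements are compared as matrices, so the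
  -- witnesses of invertibility and of the trace condition do not affect counting.
  GLWithTrace : ℕ → Carrier → Setoid (c ⊔ ℓ) ℓ
  GLWithTrace n β = On.setoid (matrixSetoid n)
    (proj₁ {B = λ (X : SquareMatrix n) → IsInvertible X × tr X ≈ β})

-- On a finite setoid equality and invertibility are decidable, so by tightness the
-- apartness of a finite Heyting field is the negation of equality: it is a finite
-- field in the usual sense.
ringOf : HeytingField c ℓ₁ ℓ₂ → CommutativeRing c ℓ₁
ringOf k = HeytingCommutativeRing.commutativeRing (HeytingField.heytingCommutativeRing k)


module OverField (k : HeytingField c ℓ₁ ℓ₂) where
  open CommutativeRing (ringOf k) public using (Carrier; _≈_; 0#; setoid)
  open Matrices (ringOf k) public

{-# OPTIONS --safe #-}

-- Fix the first column (x , c) of an invertible matrix of size m + 1 and trace β. If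
-- c = 0, then the matrix is determined by the rest of its first row and by its
-- invertible lower right block A, where x = β - tr A must be nonzero, that is tr A ≠ β.
-- If c ≠ 0, choose a row f with f c = 1: multiplying on both sides by explicit
-- invertible matrices turns the matrix into the direct sum of 1 and an arbitrary
-- invertible matrix of size m, a row vector remains free, and the trace condition
-- merely fixes x. With Q = q ^ m and G the order of GLₘ this gives
--   N_β(m+1) = Q (G - N_β(m)) + (Q - 1) Q G,  that is  N_β(m+1) + Q N_β(m) = Q² G.
-- Hence N_β depends only on whether β = 0, the total z + (q - 1) w of the two counts
-- satisfies the recursion of the order of GLₘ, and z - w is multiplied by -Q.
module Submission where

open import Defs
open import Algebra.Apartness.Bundles using (HeytingField)
open import Algebra.Bundles using (Monoid; CommutativeRing)
import Algebra.Definitions as AlgebraDefinitions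
import Algebra.Properties.Monoid as MonoidProperties
import Algebra.Properties.Ring as RingProperties
import Algebra.Properties.Semiring.Sum as SemiringSum
open import Data.Fin.Base using (Fin; zero; suc; combine; remQuot; join; splitAt)
open import Data.Fin.Permutation using (↔⇒≡)
import Data.Fin.Properties as Fin
open import Data.Integer.Base as ℤ using (ℤ; +_; -1ℤ) renaming (_^_ to _^ℤ_)
import Data.Integer.Properties as ℤ
import Data.Integer.Tactic.RingSolver as ℤ-Solver
open import Data.List.Base using (applyUpTo; _∷ʳ_)
open import Data.List.Properties using (applyUpTo-∷ʳ)
open import Data.Nat.Base as ℕ using (ℕ; zero; suc; _≥_; _∸_; _^_; NonZero; >-nonZero) renaming (_*_ to _*ℕ_)
open import Data.Nat.Combinatorics using (_C_; nC1≡n; nCk+nC[k+1]≡[n+1]C[k+1])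
open import Data.Nat.ListAction using (product)
open import Data.Nat.ListAction.Properties using (product-++)
import Data.Nat.Properties as ℕ
import Data.Nat.Tactic.RingSolver as ℕ-Solver
open import Data.Product.Base using (_×_; _,_; proj₁; proj₂; ∃-syntax; uncurry)
open import Data.Product.Relation.Binary.Pointwise.NonDependent using () renaming (×-setoid to _×ₛ_)
import Data.Rational.Base as ℚ
import Data.Rational.Properties as ℚ
import Data.Rational.Unnormalised.Base as ℚᵘ
import Data.Rational.Unnormalised.Properties as ℚᵘ
open import Data.Sum.Base using (_⊎_; inj₁; inj₂)
open import Data.Vec.Functional using (Vector; _∷_; head; tail)
import Data.Vec.Functional.Relation.Binary.Equality.Setoid as VectorEquality
open import Function.Base using (_∘_)
open import Function.Bundles using (Inverse)
open import Function.Construct.Composition using () renaming (inverse to infixr 9 _⨾_)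
open import Function.Construct.Symmetry using () renaming (inverse to symmetric)
open import Level using (Level; _⊔_)
open import Relation.Binary.Bundles using (Setoid)
import Relation.Binary.Construct.On as On
open import Relation.Binary.PropositionalEquality.Core as ≡ using (_≡_)
import Relation.Binary.PropositionalEquality.Properties as ≡
import Relation.Binary.Reasoning.Setoid as SetoidReasoning
open import Relation.Nullary.Decidable.Core using (Dec; yes; no; map′)
open import Relation.Nullary.Negation.Core using (¬_; contradiction)
open import Relation.Unary using (Decidable)

private
  variable
    a b ℓ₁ ℓ₂ p : Level

-- Counting in finite setoids

module Cardinality where
  open Setoid using (Carrier)

  module _ {A : Setoid a ℓ₁} {B : Setoid b ℓ₂} where
    private
      module A = Setoid A
      module B = Setoid B

    strictInverse : (f : A.Carrier → B.Carrier) (g : B.Carrier → A.Carrier) →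
      (∀ {x y} → x A.≈ y → f x B.≈ f y) → (∀ {x y} → x B.≈ y → g x A.≈ g y) →
      (∀ y → f (g y) B.≈ y) → (∀ x → g (f x) A.≈ x) → Inverse A B
    strictInverse f g f-cong g-cong fg gf = record
      { to = f
      ; from = g
      ; to-cong = f-cong
      ; from-cong = g-cong
      ; inverse = (λ x≈gy → B.trans (f-cong x≈gy) (fg _))
                , (λ y≈fx → A.trans (g-cong y≈fx) (gf _))
      }

  infixl 5 _∣_
  -- Elements carry a proof of `P`, but equality looks only at the first component, so a count never
  -- depends on which proof was given. `GLWithTrace` is encoded in the same way.
  _∣_ : (S : Setoid a ℓ₁) → (Carrier S → Set p) → Setoid (a ⊔ p) ℓ₁
  S ∣ P = On.setoid S (proj₁ {B = P})

  HasCardinality-unique : ∀ {S : Setoid a ℓ₁} {m n} → HasCardinality S m → HasCardinality S n → m ≡ n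
  HasCardinality-unique S≅m S≅n = ↔⇒≡ (symmetric S≅m ⨾ S≅n)

  -- Equality is tested on the codes in `Fin n`. All case distinctions on scalars, vectors and
  -- traces rest on this.
  decEq : ∀ {S : Setoid a ℓ₁} {n} → HasCardinality S n → ∀ x y → Dec (Setoid._≈_ S x y)
  decEq {S = S} S≅n x y =
    map′ (λ eq → trans (sym (strictlyInverseʳ x)) (trans (from-cong eq) (strictlyInverseʳ y)))
         to-cong (to x Fin.≟ to y)
    where
    open Inverse S≅n
    open Setoid S

  singleton-card : ∀ {S : Setoid a ℓ₁} x → (∀ y → Setoid._≈_ S x y) → HasCardinality S 1
  singleton-card {S = S} x x≈ = strictInverse (λ _ → zero) (λ _ → x) (λ _ → ≡.refl)
    (λ _ → Setoid.refl S) (λ { zero → ≡.refl }) x≈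

  empty-card : ∀ {S : Setoid a ℓ₁} → ¬ Carrier S → HasCardinality S 0
  empty-card {S = S} ¬x = strictInverse (λ x → contradiction x ¬x) (λ ())
    (λ {x} _ → contradiction x ¬x) (λ { {()} }) (λ ()) (λ x → contradiction x ¬x)

  -- Induction on `n`, deciding `P` at `zero` and shifting the codes by one when it holds there. It
  -- supplies the finiteness of complements.
  decidableSubset-card : ∀ n {P : Fin n → Set p} → Decidable P →
    ∃[ m ] HasCardinality (≡.setoid (Fin n) ∣ P) m
  decidableSubset-card zero P? = 0 , empty-card (λ ())
  decidableSubset-card (suc n) {P} P? with decidableSubset-card n (P? ∘ suc) | P? zero
  ... | m , rest | yes p₀ = suc m , strictInverse
    (λ { (zero , _) → zero ; (suc i , p) → suc (to (i , p)) })
    (λ { zero → zero , p₀ ; (suc j) → suc (proj₁ (from j)) , proj₂ (from j) })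
    (λ { {zero , _} {zero , _} _ → ≡.refl
       ; {suc i , _} {suc .i , _} ≡.refl → ≡.cong suc (to-cong ≡.refl) })
    (λ { ≡.refl → ≡.refl })
    (λ { zero → ≡.refl ; (suc j) → ≡.cong suc (strictlyInverseˡ j) })
    (λ { (zero , _) → ≡.refl ; (suc i , p) → ≡.cong suc (strictlyInverseʳ (i , p)) })
    where
    open Inverse rest
  ... | m , rest | no ¬p₀ = m , strictInverse
    (λ { (zero , p) → contradiction p ¬p₀ ; (suc i , p) → to (i , p) })
    (λ j → suc (proj₁ (from j)) , proj₂ (from j))
    (λ { {zero , p} _ → contradiction p ¬p₀
       ; {suc i , _} {suc .i , _} ≡.refl → to-cong ≡.refl })
    (λ { ≡.refl → ≡.refl })
    strictlyInverseˡ
    (λ { (zero , p) → contradiction p ¬p₀ ; (suc i , p) → ≡.cong suc (strictlyInverseʳ (i , p)) })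
    where
    open Inverse rest

  module _ {S : Setoid a ℓ₁} {P : Carrier S → Set p} (P? : Decidable P)
           (P-resp : ∀ {x y} → Setoid._≈_ S x y → P x → P y) where
    open Setoid S using (_≈_; refl; sym; trans)

    -- Each element is coded in the part chosen by `P?`. Since `P` respects equality, equal elements
    -- land in the same part.
    card-⊎ : ∀ {m n} → HasCardinality (S ∣ P) m → HasCardinality (S ∣ (¬_ ∘ P)) n →
      HasCardinality S (m ℕ.+ n)
    card-⊎ {m} {n} P≅m ¬P≅n = strictInverse (λ x → join m n (code x (P? x)))
      (λ i → decode (splitAt m i))
      (λ {x} {y} x≈y → ≡.cong (join m n) (code-cong x≈y (P? x) (P? y)))
      (λ { ≡.refl → refl })
      (λ i → ≡.trans (≡.cong (join m n) (code-decode (splitAt m i) (P? _))) (Fin.join-splitAt m n i))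
      (λ x → ≡.subst (λ t → decode t ≈ x) (≡.sym (Fin.splitAt-join m n (code x (P? x))))
               (decode-code x (P? x)))
      where
      module P = Inverse P≅m
      module Q = Inverse ¬P≅n

      -- The decision is an argument of its own, so that the lemmas below can match on it without
      -- abstracting over `P? x`.
      code : ∀ x → Dec (P x) → Fin m ⊎ Fin n
      code x (yes px) = inj₁ (P.to (x , px))
      code x (no ¬px) = inj₂ (Q.to (x , ¬px))

      decode : Fin m ⊎ Fin n → Carrier S
      decode (inj₁ i) = proj₁ (P.from i)
      decode (inj₂ j) = proj₁ (Q.from j)

      code-cong : ∀ {x y} → x ≈ y → (dx : Dec (P x)) (dy : Dec (P y)) → code x dx ≡ code y dy
      code-cong x≈y (yes px) (yes py) = ≡.cong inj₁ (P.to-cong x≈y)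
      code-cong x≈y (yes px) (no ¬py) = contradiction (P-resp x≈y px) ¬py
      code-cong x≈y (no ¬px) (yes py) = contradiction (P-resp (sym x≈y) py) ¬px
      code-cong x≈y (no ¬px) (no ¬py) = ≡.cong inj₂ (Q.to-cong x≈y)

      code-decode : ∀ s (d : Dec (P (decode s))) → code (decode s) d ≡ s
      code-decode (inj₁ i) (yes pi) = ≡.cong inj₁ (≡.trans (P.to-cong refl) (P.strictlyInverseˡ i))
      code-decode (inj₁ i) (no ¬pi) = contradiction (proj₂ (P.from i)) ¬pi
      code-decode (inj₂ j) (yes pj) = contradiction pj (proj₂ (Q.from j))
      code-decode (inj₂ j) (no ¬pj) = ≡.cong inj₂ (≡.trans (Q.to-cong refl) (Q.strictlyInverseˡ j))

      decode-code : ∀ x (d : Dec (P x)) → decode (code x d) ≈ x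
      decode-code x (yes px) = P.strictlyInverseʳ (x , px)
      decode-code x (no ¬px) = Q.strictlyInverseʳ (x , ¬px)

    -- Moved to `Fin n`, the complement becomes a decidable subset, hence finite; counting `S` in
    -- two ways then relates the sizes. The sum `m + m′ ≡ n` avoids truncated subtraction.
    complement-card : ∀ {m n} → HasCardinality S n → HasCardinality (S ∣ P) m →
      ∃[ m′ ] m ℕ.+ m′ ≡ n × HasCardinality (S ∣ (¬_ ∘ P)) m′
    complement-card {m} {n} S≅n P≅m = _ ,
      HasCardinality-unique (card-⊎ P≅m ¬P≅m′) S≅n , ¬P≅m′
      where
      open Inverse S≅n

      ¬P? : Decidable (λ i → ¬ P (from i))
      ¬P? i with P? (from i)
      ... | yes pi = no (λ ¬pi → ¬pi pi)
      ... | no ¬pi = yes ¬pi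

      ¬P≅m′ : HasCardinality (S ∣ (¬_ ∘ P)) _
      ¬P≅m′ = strictInverse {A = S ∣ (¬_ ∘ P)} {B = ≡.setoid (Fin n) ∣ (λ i → ¬ P (from i))}
        (λ (x , ¬px) → to x , λ p → ¬px (P-resp (strictlyInverseʳ x) p))
        (λ (i , ¬pi) → from i , ¬pi)
        to-cong from-cong (strictlyInverseˡ ∘ proj₁) (strictlyInverseʳ ∘ proj₁)
        ⨾ proj₂ (decidableSubset-card n ¬P?)

  module _ {E : Setoid a ℓ₁} {B : Setoid b ℓ₂} (π : Carrier E → Carrier B)
           (π-cong : ∀ {x y} → Setoid._≈_ E x y → Setoid._≈_ B (π x) (π y)) where
    private
      module E = Setoid E
      module B = Setoid B

    -- A point is coded by the index of its image together with its index within the fiber; all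
    -- fibers have the same size `n`.
    card-fibration : ∀ {m n} → HasCardinality B m →
      (∀ y → HasCardinality (E ∣ (λ x → π x B.≈ y)) n) → HasCardinality E (m ℕ.* n)
    card-fibration {m} {n} B≅m fiber≅n = strictInverse {A = E} {B = ≡.setoid (Fin (m ℕ.* n))}
      (λ x → combine (base x) (F.to (base x) (x , over x)))
      (λ i → decode (remQuot n i))
      (λ {x} {y} x≈y → code-cong (to-cong (π-cong x≈y)) x≈y)
      (λ { ≡.refl → E.refl })
      (λ i → ≡.trans (code-decode (remQuot n i)) (Fin.combine-remQuot {m} n i))
      (λ x → ≡.subst (λ t → decode t E.≈ x) (≡.sym (Fin.remQuot-combine (base x) _))
               (F.strictlyInverseʳ (base x) (x , over x)))
      where
      open Inverse B≅m
      module F i = Inverse (fiber≅n (from i))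

      base : E.Carrier → Fin m
      base x = to (π x)

      -- The point is placed in the fiber over the representative `from (base x)` of `π x`, so that
      -- the fiber is chosen by the index alone.
      over : ∀ x → π x B.≈ from (base x)
      over x = B.sym (strictlyInverseʳ (π x))

      decode : Fin m × Fin n → E.Carrier
      decode (i , j) = proj₁ (F.from i j)

      code-cong : ∀ {i j x y} {p : π x B.≈ from i} {p′ : π y B.≈ from j} → i ≡ j → x E.≈ y →
        combine i (F.to i (x , p)) ≡ combine j (F.to j (y , p′))
      code-cong {i} ≡.refl x≈y = ≡.cong (combine i) (F.to-cong i x≈y)

      code-decode : ∀ s → combine (base (decode s)) (F.to (base (decode s)) (decode s , over (decode s)))
        ≡ uncurry combine s
      code-decode (i , j) = ≡.trans
        (code-cong {p′ = proj₂ (F.from i j)}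
          (≡.trans (to-cong (proj₂ (F.from i j))) (strictlyInverseˡ i)) E.refl)
        (≡.cong (combine i) (F.strictlyInverseˡ i j))

  -- The first projection is a fibration whose fibers are all copies of `B`.
  card-× : ∀ {A : Setoid a ℓ₁} {B : Setoid b ℓ₂} {m n} → HasCardinality A m → HasCardinality B n →
    HasCardinality (A ×ₛ B) (m ℕ.* n)
  card-× {A = A} {B = B} A≅m B≅n = card-fibration proj₁ proj₁ A≅m λ x →
    strictInverse (λ ((_ , y) , _) → y) (λ y → (x , y) , A.refl) proj₂ (A.refl ,_)
      (λ _ → B.refl) (λ (_ , x′≈x) → A.sym x′≈x , B.refl)
    ⨾ B≅n
    where
    module A = Setoid A
    module B = Setoid B

  vector-card : ∀ {S : Setoid a ℓ₁} {q} → HasCardinality S q → ∀ n →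
    HasCardinality (VectorEquality.≋-setoid S n) (q ^ n)
  vector-card S≅q zero = singleton-card (λ ()) (λ _ ())
  vector-card {S = S} S≅q (suc n) = strictInverse
    (λ v → head v , tail v) (λ (x , v) → x ∷ v)
    (λ v≋w → v≋w zero , v≋w ∘ suc)
    (λ { (x≈y , _) zero → x≈y ; (_ , v≋w) (suc i) → v≋w i })
    (λ _ → S.refl , λ _ → S.refl)
    (λ { _ zero → S.refl ; _ (suc i) → S.refl })
    ⨾ card-× S≅q (vector-card S≅q n)
    where module S = Setoid S

open Cardinality

-- Invertible matrices in block form

module InvertibleElements {a ℓ} (M : Monoid a ℓ) where
  open Monoid M
  open MonoidProperties M using (cancelᶜ; cancelˡ; cancelʳ)

  Invertible : Carrier → Set (a ⊔ ℓ)
  Invertible = AlgebraDefinitions.Invertible _≈_ ε _∙_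

  invertible-resp : ∀ {x y} → x ≈ y → Invertible x → Invertible y
  invertible-resp x≈y (x⁻¹ , l , r) =
    x⁻¹ , trans (∙-congˡ (sym x≈y)) l , trans (∙-congʳ (sym x≈y)) r

  invertible-∙ : ∀ x y → Invertible x → Invertible y → Invertible (x ∙ y)
  invertible-∙ _ _ (x⁻¹ , lx , rx) (y⁻¹ , ly , ry) = y⁻¹ ∙ x⁻¹ ,
    trans (cancelᶜ lx _ _) ly , trans (cancelᶜ ry _ _) rx

  invertible⁻¹ : ∀ {x} ((x⁻¹ , _) : Invertible x) → Invertible x⁻¹
  invertible⁻¹ {x} (_ , l , r) = x , r , l

  invertible-cancelˡ : ∀ x y → Invertible x → Invertible (x ∙ y) → Invertible y
  invertible-cancelˡ _ _ x-inv@(_ , l , _) xy-inv =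
    invertible-resp (cancelˡ l _) (invertible-∙ _ _ (invertible⁻¹ x-inv) xy-inv)

  invertible-cancelʳ : ∀ x y → Invertible y → Invertible (x ∙ y) → Invertible x
  invertible-cancelʳ _ _ y-inv@(_ , _ , r) xy-inv =
    invertible-resp (cancelʳ r _) (invertible-∙ _ _ xy-inv (invertible⁻¹ y-inv))

module MatrixAlgebra {c ℓ} (R : CommutativeRing c ℓ) where
  open CommutativeRing R hiding (zero)
  open Matrices R
  open RingProperties ring
  open SemiringSum semiring
    using (sum; sum-cong-≋; sum-replicate-zero; ∑-distrib-+; ∑-comm; *-distribˡ-sum; *-distribʳ-sum)
  open SetoidReasoning setoid

  -- Row vectors, column vectors and the matrix monoid

  infix 4 _≋_
  _≋_ : ∀ {n} → SquareMatrix n → SquareMatrix n → Set ℓ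
  _≋_ {n} = Setoid._≈_ (matrixSetoid n)

  infix 9 _∙_
  _∙_ : ∀ {n} → Vector Carrier n → Vector Carrier n → Carrier
  f ∙ v = sum (λ l → f l * v l)

  ∙-zeroˡ : ∀ {n} (v : Vector Carrier n) → (λ _ → 0#) ∙ v ≈ 0#
  ∙-zeroˡ {n} v = trans (sum-cong-≋ {n} (λ l → zeroˡ (v l))) (sum-replicate-zero n)

  ∙-zeroʳ : ∀ {n} (f : Vector Carrier n) → f ∙ (λ _ → 0#) ≈ 0#
  ∙-zeroʳ {n} f = trans (sum-cong-≋ {n} (λ l → zeroʳ (f l))) (sum-replicate-zero n)

  ∙-scaleˡ : ∀ {n} x (f v : Vector Carrier n) → (λ l → x * f l) ∙ v ≈ x * f ∙ v
  ∙-scaleˡ x f v = trans (sum-cong-≋ (λ l → *-assoc x (f l) (v l)))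
    (sym (*-distribˡ-sum x (λ l → f l * v l)))

  ∙-scaleʳ : ∀ {n} x (f v : Vector Carrier n) → f ∙ (λ l → v l * x) ≈ f ∙ v * x
  ∙-scaleʳ x f v = trans (sum-cong-≋ (λ l → sym (*-assoc (f l) (v l) x)))
    (sym (*-distribʳ-sum x (λ l → f l * v l)))

  ∙-distribʳ : ∀ {n} (v f g : Vector Carrier n) → (λ l → f l + g l) ∙ v ≈ f ∙ v + g ∙ v
  ∙-distribʳ v f g = trans (sum-cong-≋ (λ l → distribʳ (v l) (f l) (g l)))
    (∑-distrib-+ (λ l → f l * v l) (λ l → g l * v l))

  ∙-distribˡ : ∀ {n} (f v w : Vector Carrier n) → f ∙ (λ l → v l + w l) ≈ f ∙ v + f ∙ w
  ∙-distribˡ f v w = trans (sum-cong-≋ (λ l → distribˡ (f l) (v l) (w l)))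
    (∑-distrib-+ (λ l → f l * v l) (λ l → f l * w l))

  ∙-neg : ∀ {n} (f v : Vector Carrier n) → (λ l → - f l) ∙ v ≈ - f ∙ v
  ∙-neg f v = begin
    (λ l → - f l) ∙ v       ≈⟨ sum-cong-≋ (λ l → *-congʳ (sym (-1*x≈-x (f l)))) ⟩
    (λ l → - 1# * f l) ∙ v  ≈⟨ ∙-scaleˡ (- 1#) f v ⟩
    - 1# * f ∙ v            ≈⟨ -1*x≈-x _ ⟩
    - f ∙ v                 ∎

  ∙-identityˡ : ∀ {n} (i : Fin n) (v : Vector Carrier n) → identityMatrix i ∙ v ≈ v i
  ∙-identityˡ zero v = trans (+-cong (*-identityˡ _) (∙-zeroˡ (tail v))) (+-identityʳ _)
  ∙-identityˡ (suc i) v = trans (+-cong (zeroˡ _) (∙-identityˡ i (tail v))) (+-identityˡ _)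

  ∙-identityʳ : ∀ {n} (j : Fin n) (v : Vector Carrier n) → v ∙ (λ l → identityMatrix l j) ≈ v j
  ∙-identityʳ zero v = trans (+-cong (*-identityʳ _) (∙-zeroʳ (tail v))) (+-identityʳ _)
  ∙-identityʳ (suc j) v = trans (+-cong (zeroʳ _) (∙-identityʳ j (tail v))) (+-identityˡ _)

  infixl 7 _⊙_
  _⊙_ : ∀ {n} → Vector Carrier n → SquareMatrix n → Vector Carrier n
  (f ⊙ A) j = f ∙ (λ l → A l j)

  -- The two summations are interchanged. With `f` a row of one matrix and `v` a column of another,
  -- this is associativity of the matrix product.
  ∙-⊙-assoc : ∀ {n} (f : Vector Carrier n) A v → (f ⊙ A) ∙ v ≈ f ∙ (λ k → A k ∙ v)
  ∙-⊙-assoc f A v = begin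
    sum (λ l → sum (λ k → f k * A k l) * v l)    ≈⟨ sum-cong-≋ (λ l → *-distribʳ-sum (v l) (λ k → f k * A k l)) ⟩
    sum (λ l → sum (λ k → f k * A k l * v l))    ≈⟨ ∑-comm (λ l k → f k * A k l * v l) ⟩
    sum (λ k → sum (λ l → f k * A k l * v l))    ≈⟨ sum-cong-≋ (λ k → sum-cong-≋ (λ l → *-assoc (f k) (A k l) (v l))) ⟩
    sum (λ k → sum (λ l → f k * (A k l * v l)))  ≈⟨ sum-cong-≋ (λ k → *-distribˡ-sum (f k) (λ l → A k l * v l)) ⟨
    sum (λ k → f k * sum (λ l → A k l * v l))    ∎

  matrixMonoid : ℕ → Monoid c ℓ
  matrixMonoid n = record
    { Carrier = SquareMatrix n
    ; _≈_ = _≋_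
    ; _∙_ = _⊗_
    ; ε = identityMatrix
    ; isMonoid = record
      { isSemigroup = record
        { isMagma = record
          { isEquivalence = Setoid.isEquivalence (matrixSetoid n)
          ; ∙-cong = λ X≋X′ Y≋Y′ i j → sum-cong-≋ (λ l → *-cong (X≋X′ i l) (Y≋Y′ l j))
          }
        ; assoc = λ X Y Z i j → ∙-⊙-assoc (X i) Y (λ l → Z l j)
        }
      ; identity = (λ X i j → ∙-identityˡ i (λ l → X l j)) , (λ X i j → ∙-identityʳ j (X i))
      }
    }

  module _ {n : ℕ} where
    open InvertibleElements (matrixMonoid n) public using
      (invertible-resp; invertible-∙; invertible-cancelˡ; invertible-cancelʳ)

  tr-cong : ∀ {n} {X Y : SquareMatrix n} → X ≋ Y → tr X ≈ tr Y
  tr-cong X≋Y = sum-cong-≋ (λ i → X≋Y i i)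

  -- Block matrices and triangular factors

  block : ∀ {n} → Carrier → Vector Carrier n → Vector Carrier n → SquareMatrix n → SquareMatrix (suc n)
  block x r c A zero    zero    = x
  block x r c A zero    (suc j) = r j
  block x r c A (suc i) zero    = c i
  block x r c A (suc i) (suc j) = A i j

  row column : ∀ {n} → SquareMatrix (suc n) → Vector Carrier n
  row X = tail (head X)
  column X = head ∘ tail X

  minor : ∀ {n} → SquareMatrix (suc n) → SquareMatrix n
  minor X i j = X (suc i) (suc j)

  -- Reduces every matrix identity below to four identities, one for each block.
  ≋-block : ∀ {n} {X : SquareMatrix (suc n)} {x r c A} → X zero zero ≈ x → (∀ j → row X j ≈ r j) →
    (∀ i → column X i ≈ c i) → minor X ≋ A → X ≋ block x r c A
  ≋-block x r c A zero    zero    = x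
  ≋-block x r c A zero    (suc j) = r j
  ≋-block x r c A (suc i) zero    = c i
  ≋-block x r c A (suc i) (suc j) = A i j

  identity-block : ∀ {n} → block 1# (λ _ → 0#) (λ _ → 0#) identityMatrix ≋ identityMatrix {suc n}
  identity-block zero    zero    = refl
  identity-block zero    (suc j) = refl
  identity-block (suc i) zero    = refl
  identity-block (suc i) (suc j) = refl

  -- As a left factor it changes only the first row; as a right factor it scales the first column by
  -- `x` and adds multiples of the old first column to the others.
  upper : ∀ {n} → Carrier → Vector Carrier n → SquareMatrix (suc n)
  upper x r = block x r (λ _ → 0#) identityMatrix

  diagonal : ∀ {n} → SquareMatrix n → SquareMatrix (suc n)
  diagonal A = block 1# (λ _ → 0#) (λ _ → 0#) A

  upper⊗ : ∀ {n} y r x g c (A : SquareMatrix n) →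
    upper y r ⊗ block x g c A ≋ block (y * x + r ∙ c) (λ j → y * g j + (r ⊙ A) j) c A
  upper⊗ y r x g c A = ≋-block refl (λ _ → refl)
    (λ i → trans (+-cong (zeroˡ _) (∙-identityˡ i c)) (+-identityˡ _))
    (λ i j → trans (+-cong (zeroˡ _) (∙-identityˡ i _)) (+-identityˡ _))

  ⊗upper : ∀ {n} x g c (A : SquareMatrix n) y r →
    block x g c A ⊗ upper y r ≋
      block (x * y) (λ j → x * r j + g j) (λ i → c i * y) (λ i j → c i * r j + A i j)
  ⊗upper x g c A y r = ≋-block
    (trans (+-congˡ (∙-zeroʳ g)) (+-identityʳ _))
    (λ j → +-congˡ (∙-identityʳ j g))
    (λ i → trans (+-congˡ (∙-zeroʳ (A i))) (+-identityʳ _))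
    (λ i j → +-congˡ (∙-identityʳ j (A i)))

  private
    module M {n : ℕ} = Setoid (matrixSetoid n)

  upper-invertible : ∀ {n} {x y} → y * x ≈ 1# → (r : Vector Carrier n) → IsInvertible (upper x r)
  upper-invertible {x = x} {y} yx≈1 r = upper y r′ , left , right
    where
    -- The first row of `upper x r ⊗ upper y r′` is `x * y` followed by `x * r′ j + r j`, which
    -- forces this choice.
    r′ : Vector Carrier _
    r′ j = - (y * r j)

    xr′+r≈0 : ∀ j → x * r′ j + r j ≈ 0#
    xr′+r≈0 j = begin
      x * - (y * r j) + r j    ≈⟨ +-congʳ (-‿distribʳ-* x _) ⟨
      - (x * (y * r j)) + r j  ≈⟨ +-congʳ (-‿cong (*-assoc x y (r j))) ⟨
      - (x * y * r j) + r j    ≈⟨ +-congʳ (-‿cong (*-congʳ (trans (*-comm x y) yx≈1))) ⟩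
      - (1# * r j) + r j       ≈⟨ +-congʳ (-‿cong (*-identityˡ (r j))) ⟩
      - r j + r j              ≈⟨ -‿inverseˡ (r j) ⟩
      0#                       ∎

    δ-entry : ∀ {n} (i j : Fin n) {z} → 0# * z + identityMatrix i j ≈ identityMatrix i j
    δ-entry i j = trans (+-congʳ (zeroˡ _)) (+-identityˡ _)

    left : upper y r′ ⊗ upper x r ≋ identityMatrix
    left = M.trans (⊗upper _ _ _ _ _ _) (M.trans
      (≋-block yx≈1 (λ j → -‿inverseʳ (y * r j)) (λ _ → zeroˡ _) (λ i j → δ-entry i j)) identity-block)

    right : upper x r ⊗ upper y r′ ≋ identityMatrix
    right = M.trans (⊗upper _ _ _ _ _ _) (M.trans
      (≋-block (trans (*-comm x y) yx≈1) xr′+r≈0 (λ _ → zeroˡ _) (λ i j → δ-entry i j)) identity-block)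

  diagonal⊗ : ∀ {n} (A B : SquareMatrix n) → diagonal A ⊗ diagonal B ≋ diagonal (A ⊗ B)
  diagonal⊗ {n} A B = ≋-block
    (trans (+-cong (*-identityˡ _) (∙-zeroˡ {n} (λ _ → 0#))) (+-identityʳ _))
    (λ j → trans (+-cong (zeroʳ _) (∙-zeroˡ (λ l → B l j))) (+-identityʳ _))
    (λ i → trans (+-cong (zeroˡ _) (∙-zeroʳ (A i))) (+-identityʳ _))
    (λ _ _ → trans (+-congʳ (zeroˡ _)) (+-identityˡ _))

  diagonal-cong : ∀ {n} {A B : SquareMatrix n} → A ≋ B → diagonal A ≋ diagonal B
  diagonal-cong A≋B = ≋-block refl (λ _ → refl) (λ _ → refl) A≋B

  diagonal-invertible : ∀ {n} {A : SquareMatrix n} → IsInvertible A → IsInvertible (diagonal A)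
  diagonal-invertible (B , BA≋1 , AB≋1) = diagonal B ,
    M.trans (diagonal⊗ B _) (M.trans (diagonal-cong BA≋1) identity-block) ,
    M.trans (diagonal⊗ _ B) (M.trans (diagonal-cong AB≋1) identity-block)

  -- In both products with the inverse `Y`, the zero blocks of `diagonal A` remove the cross terms,
  -- so the lower right blocks multiply on their own.
  diagonal-invertible⁻¹ : ∀ {n} {A : SquareMatrix n} → IsInvertible (diagonal A) → IsInvertible A
  diagonal-invertible⁻¹ (Y , left , right) = minor Y ,
    (λ i j → trans (sym (trans (+-congʳ (zeroʳ _)) (+-identityˡ _))) (left (suc i) (suc j))) ,
    (λ i j → trans (sym (trans (+-congʳ (zeroˡ _)) (+-identityˡ _))) (right (suc i) (suc j)))

  upperTriangular-factors : ∀ {n} x r (A : SquareMatrix n) →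
    diagonal A ⊗ upper x r ≋ block x r (λ _ → 0#) A
  upperTriangular-factors x r A = M.trans (⊗upper _ _ _ _ _ _) (≋-block
    (*-identityˡ x)
    (λ _ → trans (+-identityʳ _) (*-identityˡ _))
    (λ _ → zeroˡ x)
    (λ _ _ → trans (+-congʳ (zeroˡ _)) (+-identityˡ _)))

  upperTriangular-invertible : ∀ {n} {x y} → y * x ≈ 1# → ∀ r {A : SquareMatrix n} →
    IsInvertible A → IsInvertible (block x r (λ _ → 0#) A)
  upperTriangular-invertible yx≈1 r A-inv = invertible-resp (upperTriangular-factors _ r _)
    (invertible-∙ (diagonal _) (upper _ r) (diagonal-invertible A-inv) (upper-invertible yx≈1 r))

  -- Below `x` the column vanishes, so the corner of `Y` times the matrix is `Y zero zero * x`. With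
  -- `x` thus a unit, the factor `upper x r` can be cancelled.
  upperTriangular-invertible⁻¹ : ∀ {n} {x r} {A : SquareMatrix n} →
    IsInvertible (block x r (λ _ → 0#) A) → ∃[ y ] y * x ≈ 1# × IsInvertible A
  upperTriangular-invertible⁻¹ {x = x} {r} {A} X-inv@(Y , left , _) = Y zero zero , yx≈1 ,
    diagonal-invertible⁻¹ (invertible-cancelʳ (diagonal A) (upper x r) (upper-invertible yx≈1 r)
      (invertible-resp (M.sym (upperTriangular-factors _ r _)) X-inv))
    where
    yx≈1 = trans (sym (trans (+-congˡ (∙-zeroʳ (row Y))) (+-identityʳ _))) (left zero zero)

  -- Matrices with a prescribed nonzero first column below the corner

  rankOneUpdate : ∀ {n} → SquareMatrix n → Vector Carrier n → Vector Carrier n → SquareMatrix n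
  rankOneUpdate A c u i j = A i j + c i * u j

  module _ {n : ℕ} {c f : Vector Carrier n} (f∙c≈1 : f ∙ c ≈ 1#) where

    -- Here f (A + c u) = f A + (f c) u with f c = 1, so the choice of `u` gives full control over
    -- the product with `f`.
    ⊙-rankOneUpdate : ∀ A u j → (f ⊙ rankOneUpdate A c u) j ≈ (f ⊙ A) j + u j
    ⊙-rankOneUpdate A u j = begin
      (f ⊙ rankOneUpdate A c u) j            ≈⟨ ∙-distribˡ f (λ l → A l j) (λ l → c l * u j) ⟩
      (f ⊙ A) j + f ∙ (λ l → c l * u j)      ≈⟨ +-congˡ (∙-scaleʳ (u j) f c) ⟩
      (f ⊙ A) j + f ∙ c * u j                ≈⟨ +-congˡ (*-congʳ f∙c≈1) ⟩
      (f ⊙ A) j + 1# * u j                   ≈⟨ +-congˡ (*-identityˡ (u j)) ⟩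
      (f ⊙ A) j + u j                        ∎

    -- The projection 1 - c f onto the kernel of f along c.
    private
      P : SquareMatrix n
      P = rankOneUpdate identityMatrix c (λ j → - f j)

    P-∙ : ∀ i v → P i ∙ v ≈ v i + c i * - f ∙ v
    P-∙ i v = begin
      P i ∙ v                                                     ≈⟨ ∙-distribʳ v (identityMatrix i) (λ l → c i * - f l) ⟩
      identityMatrix i ∙ v + (λ l → c i * - f l) ∙ v ≈⟨ +-cong (∙-identityˡ i v) (∙-scaleˡ (c i) (λ l → - f l) v) ⟩
      v i + c i * (λ l → - f l) ∙ v                               ≈⟨ +-congˡ (*-congˡ (∙-neg f v)) ⟩
      v i + c i * - f ∙ v                                         ∎

    f⊙P≈0 : ∀ j → (f ⊙ P) j ≈ 0#
    f⊙P≈0 j = trans (⊙-rankOneUpdate identityMatrix (λ j → - f j) j) (trans (+-congʳ (∙-identityʳ j f)) (-‿inverseʳ (f j)))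

    P-idempotent : P ⊗ P ≋ P
    P-idempotent i j = begin
      (P ⊗ P) i j                 ≈⟨ P-∙ i (λ l → P l j) ⟩
      P i j + c i * - (f ⊙ P) j   ≈⟨ +-congˡ (*-congˡ (trans (-‿cong (f⊙P≈0 j)) -0#≈0#)) ⟩
      P i j + c i * 0#            ≈⟨ +-congˡ (zeroʳ (c i)) ⟩
      P i j + 0#                  ≈⟨ +-identityʳ _ ⟩
      P i j                       ∎

    P∙c≈0 : ∀ i → P i ∙ c ≈ 0#
    P∙c≈0 i = begin
      P i ∙ c              ≈⟨ P-∙ i c ⟩
      c i + c i * - f ∙ c  ≈⟨ +-congˡ (-‿distribʳ-* (c i) (f ∙ c)) ⟨
      c i - c i * f ∙ c    ≈⟨ +-congˡ (-‿cong (trans (*-congˡ f∙c≈1) (*-identityʳ (c i)))) ⟩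
      c i - c i            ≈⟨ -‿inverseʳ (c i) ⟩
      0#                   ∎

    -- As f c = 1, column vectors of length n split into multiples of c and the kernel of f. This
    -- matrix exchanges the first basis vector with (0 , c) and fixes the kernel of f, which makes
    -- it an involution.
    swap : SquareMatrix (suc n)
    swap = block 0# f c P

    swap-involutive : swap ⊗ swap ≋ identityMatrix
    swap-involutive = M.trans (≋-block
      (trans (+-congʳ (zeroˡ 0#)) (trans (+-identityˡ _) f∙c≈1))
      (λ j → trans (+-cong (zeroˡ (f j)) (f⊙P≈0 j)) (+-identityˡ 0#))
      (λ i → trans (+-cong (zeroʳ (c i)) (P∙c≈0 i)) (+-identityˡ 0#))
      λ i j → begin
        c i * f j + (P ⊗ P) i j                        ≈⟨ +-congˡ (P-idempotent i j) ⟩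
        c i * f j + (identityMatrix i j + c i * - f j) ≈⟨ +-comm _ _ ⟩
        identityMatrix i j + c i * - f j + c i * f j   ≈⟨ +-assoc _ _ _ ⟩
        identityMatrix i j + (c i * - f j + c i * f j) ≈⟨ +-congˡ (distribˡ (c i) _ _) ⟨
        identityMatrix i j + c i * (- f j + f j)       ≈⟨ +-congˡ (trans (*-congˡ (-‿inverseˡ (f j))) (zeroʳ (c i))) ⟩
        identityMatrix i j + 0#                        ≈⟨ +-identityʳ _ ⟩
        identityMatrix i j                             ∎)
      identity-block

    swap-invertible : IsInvertible swap
    swap-invertible = swap , swap-involutive , swap-involutive

    -- Every matrix X with first column (x , c) is assembled from a unique pair (s , A);
    -- here s is f times the lower right block of X.
    assemble : Carrier → Vector Carrier n → SquareMatrix n → SquareMatrix (suc n)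
    assemble x s A = block x (λ j → x * s j + (f ⊙ A) j) c (rankOneUpdate A c (λ j → s j - (f ⊙ A) j))

    -- The product `swap ⊗ diagonal A` has first column (0 , c). The left factor adds x f times the
    -- lower rows to the first row: this puts x f c = x in the corner and alters nothing else, since
    -- f annihilates the lower right block `N`. The right factor adds multiples of the first column.
    -- All factors besides `diagonal A` are invertible, so invertibility passes both ways between
    -- `A` and the assembled matrix.
    assemble-factors : ∀ x s A →
      (upper 1# (λ l → x * f l) ⊗ (swap ⊗ diagonal A)) ⊗ upper 1# s ≋ assemble x s A
    assemble-factors x s A = M.trans
      (⊗-congʳ {upper 1# s} (M.trans (⊗-congˡ {upper 1# (λ l → x * f l)} swap⊗diagonal) upper⊗reduced))
      reduced⊗upper
      where
      open Monoid (matrixMonoid (suc n)) using () renaming (∙-congˡ to ⊗-congˡ; ∙-congʳ to ⊗-congʳ)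

      N : SquareMatrix n
      N = rankOneUpdate A c (λ j → - (f ⊙ A) j)

      swap⊗diagonal : swap ⊗ diagonal A ≋ block 0# (f ⊙ A) c N
      swap⊗diagonal = ≋-block
        (trans (+-cong (zeroˡ 1#) (∙-zeroʳ f)) (+-identityˡ 0#))
        (λ j → trans (+-congʳ (zeroˡ 0#)) (+-identityˡ _))
        (λ i → trans (+-cong (*-identityʳ (c i)) (∙-zeroʳ (P i))) (+-identityʳ _))
        (λ i j → trans (+-cong (zeroʳ (c i)) (P-∙ i (λ l → A l j))) (+-identityˡ _))

      upper⊗reduced : upper 1# (λ l → x * f l) ⊗ block 0# (f ⊙ A) c N ≋ block x (f ⊙ A) c N
      upper⊗reduced = M.trans (upper⊗ _ _ _ _ _ _) (≋-block
        (begin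
          1# * 0# + (λ l → x * f l) ∙ c  ≈⟨ +-cong (zeroʳ 1#) (∙-scaleˡ x f c) ⟩
          0# + x * f ∙ c                 ≈⟨ +-identityˡ _ ⟩
          x * f ∙ c                      ≈⟨ trans (*-congˡ f∙c≈1) (*-identityʳ x) ⟩
          x                              ∎)
        (λ j → begin
          1# * (f ⊙ A) j + ((λ l → x * f l) ⊙ N) j    ≈⟨ +-cong (*-identityˡ _) (∙-scaleˡ x f (λ l → N l j)) ⟩
          (f ⊙ A) j + x * (f ⊙ N) j                   ≈⟨ +-congˡ (*-congˡ (⊙-rankOneUpdate A (λ j → - (f ⊙ A) j) j)) ⟩
          (f ⊙ A) j + x * ((f ⊙ A) j - (f ⊙ A) j)     ≈⟨ +-congˡ (trans (*-congˡ (-‿inverseʳ _)) (zeroʳ x)) ⟩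
          (f ⊙ A) j + 0#                              ≈⟨ +-identityʳ _ ⟩
          (f ⊙ A) j                                   ∎)
        (λ _ → refl) (λ _ _ → refl))

      reduced⊗upper : block x (f ⊙ A) c N ⊗ upper 1# s ≋ assemble x s A
      reduced⊗upper = M.trans (⊗upper _ _ _ _ _ _) (≋-block (*-identityʳ x) (λ _ → refl)
        (λ i → *-identityʳ (c i))
        (λ i j → begin
          c i * s j + (A i j + c i * - (f ⊙ A) j)   ≈⟨ +-comm _ _ ⟩
          A i j + c i * - (f ⊙ A) j + c i * s j     ≈⟨ +-assoc _ _ _ ⟩
          A i j + (c i * - (f ⊙ A) j + c i * s j)   ≈⟨ +-congˡ (distribˡ (c i) _ _) ⟨
          A i j + c i * (- (f ⊙ A) j + s j)         ≈⟨ +-congˡ (*-congˡ (+-comm _ _)) ⟩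
          A i j + c i * (s j - (f ⊙ A) j)           ∎))

    assemble-invertible : ∀ x s {A} → IsInvertible A → IsInvertible (assemble x s A)
    assemble-invertible x s {A} A-inv = invertible-resp (assemble-factors x s A)
      (invertible-∙ (U ⊗ (swap ⊗ diagonal A)) (upper 1# s)
        (invertible-∙ U (swap ⊗ diagonal A) (upper-invertible (*-identityˡ 1#) _)
          (invertible-∙ swap (diagonal A) swap-invertible (diagonal-invertible A-inv)))
        (upper-invertible (*-identityˡ 1#) s))
      where U = upper 1# (λ l → x * f l)

    assemble-invertible⁻¹ : ∀ x s {A} → IsInvertible (assemble x s A) → IsInvertible A
    assemble-invertible⁻¹ x s {A} X-inv = diagonal-invertible⁻¹
      (invertible-cancelˡ swap (diagonal A) swap-invertible
        (invertible-cancelˡ U (swap ⊗ diagonal A) (upper-invertible (*-identityˡ 1#) _)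
          (invertible-cancelʳ (U ⊗ (swap ⊗ diagonal A)) (upper 1# s) (upper-invertible (*-identityˡ 1#) s)
            (invertible-resp (M.sym (assemble-factors x s A)) X-inv))))
      where U = upper 1# (λ l → x * f l)

    rankOneUpdate-cancel : ∀ A u v → (∀ j → u j + v j ≈ 0#) →
      rankOneUpdate (rankOneUpdate A c u) c v ≋ A
    rankOneUpdate-cancel A u v u+v≈0 i j = begin
      A i j + c i * u j + c i * v j    ≈⟨ +-assoc _ _ _ ⟩
      A i j + (c i * u j + c i * v j)  ≈⟨ +-congˡ (distribˡ (c i) _ _) ⟨
      A i j + c i * (u j + v j)        ≈⟨ +-congˡ (trans (*-congˡ (u+v≈0 j)) (zeroʳ (c i))) ⟩
      A i j + 0#                       ≈⟨ +-identityʳ _ ⟩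
      A i j                            ∎

    extractRow : SquareMatrix (suc n) → Vector Carrier n
    extractRow X = f ⊙ minor X

    -- The blocks of `assemble` solved for `A`: its first row gives f A = row - x s, and its lower
    -- right block A + c (s - f A) then gives A = minor + c (row - x s - s).
    extract : SquareMatrix (suc n) → SquareMatrix n
    extract X = rankOneUpdate (minor X) c
      (λ j → row X j - (X zero zero * extractRow X j + extractRow X j))

    private
      y+[z-y]≈z : ∀ y z → y + (z - y) ≈ z
      y+[z-y]≈z y z = trans (sym (+-assoc y z (- y))) (xyx⁻¹≈y y z)

    assemble-extract : ∀ X → (∀ i → column X i ≈ c i) →
      X ≋ assemble (X zero zero) (extractRow X) (extract X)
    assemble-extract X X₀≈c = ≋-block refl
      (λ j → sym (begin
        x * s j + (f ⊙ extract X) j   ≈⟨ +-congˡ (⊙-rankOneUpdate (minor X) u j) ⟩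
        x * s j + (s j + u j)         ≈⟨ +-assoc _ _ _ ⟨
        x * s j + s j + u j           ≈⟨ y+[z-y]≈z _ _ ⟩
        row X j                       ∎))
      X₀≈c
      -- Since f times `extract X` is s + u, the update made by `assemble` is s - (s + u) = -u and
      -- undoes the one made by `extract`.
      (M.sym (rankOneUpdate-cancel (minor X) u (λ j → s j - (f ⊙ extract X) j) (λ j → begin
        u j + (s j - (f ⊙ extract X) j)  ≈⟨ +-congˡ (+-congˡ (-‿cong (⊙-rankOneUpdate (minor X) u j))) ⟩
        u j + (s j - (s j + u j))        ≈⟨ +-assoc _ _ _ ⟨
        u j + s j - (s j + u j)          ≈⟨ +-congʳ (+-comm _ _) ⟩
        s j + u j - (s j + u j)          ≈⟨ -‿inverseʳ _ ⟩
        0#                               ∎)))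
      where
      x = X zero zero
      s = extractRow X
      u : Vector Carrier n
      u j = row X j - (x * s j + s j)

    extractRow-assemble : ∀ x s A j → extractRow (assemble x s A) j ≈ s j
    extractRow-assemble x s A j = trans (⊙-rankOneUpdate A (λ j → s j - (f ⊙ A) j) j) (y+[z-y]≈z _ _)

    extract-assemble : ∀ x s A → extract (assemble x s A) ≋ A
    -- Once s′ is replaced by s, the second update is g - s, the negative of the first.
    extract-assemble x s A = rankOneUpdate-cancel A (λ j → s j - g j)
      (λ j → x * s j + g j - (x * s′ j + s′ j)) (λ j → begin
      (s j - g j) + (x * s j + g j - (x * s′ j + s′ j))
        ≈⟨ +-congˡ (+-congˡ (-‿cong (+-cong (*-congˡ (s′≈s j)) (s′≈s j)))) ⟩
      (s j - g j) + (x * s j + g j - (x * s j + s j))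
        ≈⟨ +-congʳ (cancel (x * s j) (s j) (g j)) ⟨
      (x * s j + s j - (x * s j + g j)) + (x * s j + g j - (x * s j + s j))
        ≈⟨ +-congʳ (⁻¹-anti-homo‿- (x * s j + g j) (x * s j + s j)) ⟨
      - (x * s j + g j - (x * s j + s j)) + (x * s j + g j - (x * s j + s j))
        ≈⟨ -‿inverseˡ _ ⟩
      0# ∎)
      where
      g = f ⊙ A
      s′ = extractRow (assemble x s A)
      s′≈s = extractRow-assemble x s A
      cancel : ∀ z y w → (z + y) - (z + w) ≈ y - w
      cancel z y w = begin
        z + y - (z + w)        ≈⟨ +-congˡ (-‿anti-homo-+ z w) ⟩
        z + y + (- w - z)      ≈⟨ +-assoc z y _ ⟩
        z + (y + (- w - z))    ≈⟨ +-congˡ (+-assoc y (- w) (- z)) ⟨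
        z + (y - w - z)        ≈⟨ y+[z-y]≈z z (y - w) ⟩
        y - w                  ∎

    ⊙-cong : ∀ {A B : SquareMatrix n} → A ≋ B → ∀ j → (f ⊙ A) j ≈ (f ⊙ B) j
    ⊙-cong A≋B j = sum-cong-≋ (λ l → *-congˡ (A≋B l j))

    rankOneUpdate-cong : ∀ {A B : SquareMatrix n} {u v} → A ≋ B → (∀ j → u j ≈ v j) →
      rankOneUpdate A c u ≋ rankOneUpdate B c v
    rankOneUpdate-cong A≋B u≋v i j = +-cong (A≋B i j) (*-congˡ (u≋v j))

    assemble-cong : ∀ {x y s t A B} → x ≈ y → (∀ j → s j ≈ t j) → A ≋ B → assemble x s A ≋ assemble y t B
    assemble-cong x≈y s≋t A≋B = ≋-block x≈y
      (λ j → +-cong (*-cong x≈y (s≋t j)) (⊙-cong A≋B j))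
      (λ _ → refl)
      (rankOneUpdate-cong A≋B (λ j → +-cong (s≋t j) (-‿cong (⊙-cong A≋B j))))

    extractRow-cong : ∀ {X Y} → X ≋ Y → ∀ j → extractRow X j ≈ extractRow Y j
    extractRow-cong X≋Y = ⊙-cong (λ i j → X≋Y (suc i) (suc j))

    extract-cong : ∀ {X Y} → X ≋ Y → extract X ≋ extract Y
    extract-cong {X} {Y} X≋Y = rankOneUpdate-cong (λ i j → X≋Y (suc i) (suc j)) (λ j →
      +-cong (X≋Y zero (suc j)) (-‿cong (+-cong
        (*-cong (X≋Y zero zero) (extractRow-cong {X} {Y} X≋Y j)) (extractRow-cong {X} {Y} X≋Y j))))

-- Arithmetic of the recursion

module Arithmetic where
  open import Data.Nat.Base using (_+_; _*_)
  open import Relation.Binary.PropositionalEquality.Core using (refl; sym; trans; cong; cong₂)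
  open ≡.≡-Reasoning

  fromℚᵘ-homo-+ : ∀ p r → ℚ.fromℚᵘ (p ℚᵘ.+ r) ≡ ℚ.fromℚᵘ p ℚ.+ ℚ.fromℚᵘ r
  fromℚᵘ-homo-+ p r = ℚ.toℚᵘ-injective (ℚᵘ.≃-trans (ℚ.toℚᵘ-fromℚᵘ (p ℚᵘ.+ r)) (ℚᵘ.≃-sym
    (ℚᵘ.≃-trans (ℚ.toℚᵘ-homo-+ (ℚ.fromℚᵘ p) (ℚ.fromℚᵘ r))
      (ℚᵘ.+-cong (ℚ.toℚᵘ-fromℚᵘ p) (ℚ.toℚᵘ-fromℚᵘ r)))))

  fromℚᵘ-homo-* : ∀ p r → ℚ.fromℚᵘ (p ℚᵘ.* r) ≡ ℚ.fromℚᵘ p ℚ.* ℚ.fromℚᵘ r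
  fromℚᵘ-homo-* p r = ℚ.toℚᵘ-injective (ℚᵘ.≃-trans (ℚ.toℚᵘ-fromℚᵘ (p ℚᵘ.* r)) (ℚᵘ.≃-sym
    (ℚᵘ.≃-trans (ℚ.toℚᵘ-homo-* (ℚ.fromℚᵘ p) (ℚ.fromℚᵘ r))
      (ℚᵘ.*-cong (ℚ.toℚᵘ-fromℚᵘ p) (ℚ.toℚᵘ-fromℚᵘ r)))))

  -- Denominators of unnormalised fractions are computed without reduction, so the equation becomes
  -- an integer identity by cross multiplication; `fromℚᵘ` carries it back to the rationals.
  clear-denominators : ∀ N a s t n d .{{_ : NonZero n}} .{{_ : NonZero d}} →
    + n ℤ.* + d ℤ.* N ≡ a ℤ.* (s ℤ.+ t ℤ.* + d) →
    N ℚ./ 1 ≡ (a ℚ./ n) ℚ.* (s ℚ./ d ℚ.+ t ℚ./ 1)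
  clear-denominators N a s t (suc n) (suc d) eq = begin
    N ℚ./ 1                                              ≡⟨ ℚ.fromℚᵘ-cong {ℚᵘ.mkℚᵘ N 0} {a/n ℚᵘ.* (s/d ℚᵘ.+ t/1)} (ℚᵘ.*≡* cross) ⟩
    ℚ.fromℚᵘ (a/n ℚᵘ.* (s/d ℚᵘ.+ t/1))                   ≡⟨ fromℚᵘ-homo-* a/n _ ⟩
    ℚ.fromℚᵘ a/n ℚ.* ℚ.fromℚᵘ (s/d ℚᵘ.+ t/1)             ≡⟨ cong (ℚ.fromℚᵘ a/n ℚ.*_) (fromℚᵘ-homo-+ s/d t/1) ⟩
    (a ℚ./ suc n) ℚ.* (s ℚ./ suc d ℚ.+ t ℚ./ 1)          ∎
    where
    a/n = ℚᵘ.mkℚᵘ a n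
    s/d = ℚᵘ.mkℚᵘ s d
    t/1 = ℚᵘ.mkℚᵘ t 0

    cross : N ℤ.* ℚᵘ.↧ (a/n ℚᵘ.* (s/d ℚᵘ.+ t/1)) ≡ ℚᵘ.↥ (a/n ℚᵘ.* (s/d ℚᵘ.+ t/1)) ℤ.* + 1
    cross = begin
      N ℤ.* + (suc n * (suc d * 1))                ≡⟨ cong (λ e → N ℤ.* + (suc n * e)) (ℕ.*-identityʳ (suc d)) ⟩
      N ℤ.* + (suc n * suc d)                      ≡⟨ cong (N ℤ.*_) (ℤ.pos-* (suc n) (suc d)) ⟩
      N ℤ.* (+ suc n ℤ.* + suc d)                  ≡⟨ ℤ.*-comm N _ ⟩
      + suc n ℤ.* + suc d ℤ.* N                    ≡⟨ eq ⟩
      a ℤ.* (s ℤ.+ t ℤ.* + suc d)                  ≡⟨ cong (λ s → a ℤ.* (s ℤ.+ t ℤ.* + suc d)) (ℤ.*-identityʳ s) ⟨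
      a ℤ.* (s ℤ.* + 1 ℤ.+ t ℤ.* + suc d)          ≡⟨ ℤ.*-identityʳ _ ⟨
      a ℤ.* (s ℤ.* + 1 ℤ.+ t ℤ.* + suc d) ℤ.* + 1  ∎

  product-applyUpTo-suc : ∀ f m → product (applyUpTo f (suc m)) ≡ product (applyUpTo f m) * f m
  product-applyUpTo-suc f m = begin
    product (applyUpTo f (suc m))               ≡⟨ cong product (applyUpTo-∷ʳ f m) ⟨
    product (applyUpTo f m ∷ʳ f m)              ≡⟨ product-++ (applyUpTo f m) _ ⟩
    product (applyUpTo f m) * (f m * 1)         ≡⟨ cong (product (applyUpTo f m) *_) (ℕ.*-identityʳ (f m)) ⟩
    product (applyUpTo f m) * f m               ∎

  ^-[1+m]C2 : ∀ q m → q ^ (suc m C 2) ≡ q ^ m * q ^ (m C 2)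
  ^-[1+m]C2 q m = begin
    q ^ (suc m C 2)          ≡⟨ cong (q ^_) (nCk+nC[k+1]≡[n+1]C[k+1] m 1) ⟨
    q ^ (m C 1 + m C 2)      ≡⟨ cong (λ k → q ^ (k + m C 2)) (nC1≡n m) ⟩
    q ^ (m + m C 2)          ≡⟨ ℕ.^-distribˡ-+-* q m (m C 2) ⟩
    q ^ m * q ^ (m C 2)      ∎

  -- The two recursions are added with weights 1 and u; with 1 + u = q this is the step from the
  -- order of GLₙ to that of the next group. Adding `Q * G` to both sides keeps the computation in
  -- the natural numbers.
  total-step : ∀ u Q r {G z w z′ w′} → z + u * w ≡ G →
    z′ + Q * z ≡ Q * Q * G → w′ + Q * w ≡ Q * Q * G → 1 + r ≡ (1 + u) * Q →
    z′ + u * w′ ≡ Q * G * r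
  total-step u Q r {G} {z} {w} {z′} {w′} total z-eq w-eq r-eq = ℕ.+-cancelʳ-≡ (Q * G) _ _ (begin
    z′ + u * w′ + Q * G                 ≡⟨ cong (λ G → z′ + u * w′ + Q * G) total ⟨
    z′ + u * w′ + Q * (z + u * w)       ≡⟨ regroup u Q z w z′ w′ ⟩
    z′ + Q * z + u * (w′ + Q * w)       ≡⟨ cong₂ (λ x y → x + u * y) z-eq w-eq ⟩
    Q * Q * G + u * (Q * Q * G)         ≡⟨ factor u Q G ⟩
    Q * G * ((1 + u) * Q)               ≡⟨ cong (Q * G *_) r-eq ⟨
    Q * G * (1 + r)                     ≡⟨ expand (Q * G) r ⟩
    Q * G * r + Q * G                   ∎)
    where
    regroup : ∀ u Q z w z′ w′ → z′ + u * w′ + Q * (z + u * w) ≡ z′ + Q * z + u * (w′ + Q * w)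
    regroup = ℕ-Solver.solve-∀
    factor : ∀ u Q G → Q * Q * G + u * (Q * Q * G) ≡ Q * G * ((1 + u) * Q)
    factor = ℕ-Solver.solve-∀
    expand : ∀ x r → x * (1 + r) ≡ x * r + x
    expand = ℕ-Solver.solve-∀

  -- Subtracting the two recursions gives z′ - w′ = -Q (z - w). The difference `D` is an integer
  -- because its sign alternates.
  difference-step : ∀ Q {z w z′ w′} D → + z ≡ + w ℤ.+ D → z′ + Q * z ≡ w′ + Q * w →
    + z′ ≡ + w′ ℤ.+ -1ℤ ℤ.* (+ Q ℤ.* D)
  difference-step Q {z} {w} {z′} {w′} D z≡w+D eq = begin
    + z′                                                ≡⟨ add-sub (+ z′) (+ Q ℤ.* + z) ⟩
    (+ z′ ℤ.+ + Q ℤ.* + z) ℤ.- + Q ℤ.* + z              ≡⟨ cong (λ x → x ℤ.- + Q ℤ.* + z) eqℤ ⟩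
    (+ w′ ℤ.+ + Q ℤ.* + w) ℤ.- + Q ℤ.* + z              ≡⟨ cong (λ x → (+ w′ ℤ.+ + Q ℤ.* + w) ℤ.- + Q ℤ.* x) z≡w+D ⟩
    (+ w′ ℤ.+ + Q ℤ.* + w) ℤ.- + Q ℤ.* (+ w ℤ.+ D)      ≡⟨ cancel (+ w′) (+ Q) (+ w) D ⟩
    + w′ ℤ.+ -1ℤ ℤ.* (+ Q ℤ.* D)                        ∎
    where
    add-sub : ∀ x y → x ≡ x ℤ.+ y ℤ.- y
    add-sub = ℤ-Solver.solve-∀
    cancel : ∀ w′ Q w D → (w′ ℤ.+ Q ℤ.* w) ℤ.- Q ℤ.* (w ℤ.+ D) ≡ w′ ℤ.+ -1ℤ ℤ.* (Q ℤ.* D)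
    cancel = ℤ-Solver.solve-∀
    eqℤ : + z′ ℤ.+ + Q ℤ.* + z ≡ + w′ ℤ.+ + Q ℤ.* + w
    eqℤ = begin
      + z′ ℤ.+ + Q ℤ.* + z  ≡⟨ cong (λ x → + z′ ℤ.+ x) (ℤ.pos-* Q z) ⟨
      + z′ ℤ.+ + (Q * z)    ≡⟨ cong +_ eq ⟩
      + w′ ℤ.+ + (Q * w)    ≡⟨ cong (λ x → + w′ ℤ.+ x) (ℤ.pos-* Q w) ⟩
      + w′ ℤ.+ + Q ℤ.* + w  ∎

  -- The counts z and w of trace zero and of a fixed nonzero trace are determined by
  -- z + u w and z - w, where q = 1 + u.
  module _ (u c Π z w : ℕ) (s : ℤ) (total : z + u * w ≡ c * (u * Π)) where

    private
      totalℤ : + z ℤ.+ + u ℤ.* + w ≡ + (c * u) ℤ.* + Π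
      totalℤ = begin
        + z ℤ.+ + u ℤ.* + w     ≡⟨ cong (λ x → + z ℤ.+ x) (ℤ.pos-* u w) ⟨
        + (z + u * w)           ≡⟨ cong +_ total ⟩
        + (c * (u * Π))         ≡⟨ cong +_ (ℕ.*-assoc c u Π) ⟨
        + (c * u * Π)           ≡⟨ ℤ.pos-* (c * u) Π ⟩
        + (c * u) ℤ.* + Π       ∎

    -- With q = 1 + u, q z = (z + u w) + u (z - w). The factors `+ 1` are the second denominator
    -- expected by `clear-denominators`.
    solve-z : + z ≡ + w ℤ.+ s ℤ.* + c →
      + suc u ℤ.* + 1 ℤ.* + z ≡ + (c * u) ℤ.* (s ℤ.+ + Π ℤ.* + 1)
    solve-z diff = begin
      + suc u ℤ.* + 1 ℤ.* + z                            ≡⟨ split (+ u) (+ z) ⟩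
      + z ℤ.+ + u ℤ.* + z                                ≡⟨ cong (λ x → + z ℤ.+ + u ℤ.* x) diff ⟩
      + z ℤ.+ + u ℤ.* (+ w ℤ.+ s ℤ.* + c)                ≡⟨ regroup (+ z) (+ u) (+ w) s (+ c) ⟩
      (+ z ℤ.+ + u ℤ.* + w) ℤ.+ (+ c ℤ.* + u) ℤ.* s      ≡⟨ cong₂ (λ x y → x ℤ.+ y ℤ.* s) totalℤ (sym (ℤ.pos-* c u)) ⟩
      + (c * u) ℤ.* + Π ℤ.+ + (c * u) ℤ.* s              ≡⟨ factor (+ (c * u)) s (+ Π) ⟩
      + (c * u) ℤ.* (s ℤ.+ + Π ℤ.* + 1)                  ∎
      where
      split : ∀ u z → (+ 1 ℤ.+ u) ℤ.* + 1 ℤ.* z ≡ z ℤ.+ u ℤ.* z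
      split = ℤ-Solver.solve-∀
      regroup : ∀ z u w s c → z ℤ.+ u ℤ.* (w ℤ.+ s ℤ.* c) ≡ (z ℤ.+ u ℤ.* w) ℤ.+ (c ℤ.* u) ℤ.* s
      regroup = ℤ-Solver.solve-∀
      factor : ∀ a s Π → a ℤ.* Π ℤ.+ a ℤ.* s ≡ a ℤ.* (s ℤ.+ Π ℤ.* + 1)
      factor = ℤ-Solver.solve-∀

    -- From q w = (z + u w) - (z - w), multiplied by u to clear the denominator q - 1. Here the sign
    -- of z - w is opposite to `s`.
    solve-w : + z ≡ + w ℤ.+ -1ℤ ℤ.* s ℤ.* + c →
      + suc u ℤ.* + u ℤ.* + w ≡ + (c * u) ℤ.* (s ℤ.+ + Π ℤ.* + u)
    solve-w diff = begin
      + suc u ℤ.* + u ℤ.* + w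
        ≡⟨ split (+ u) (+ w) s (+ c) ⟩
      + u ℤ.* ((+ w ℤ.+ -1ℤ ℤ.* s ℤ.* + c) ℤ.+ + u ℤ.* + w) ℤ.+ (+ c ℤ.* + u) ℤ.* s
        ≡⟨ cong₂ (λ x y → + u ℤ.* (x ℤ.+ + u ℤ.* + w) ℤ.+ y ℤ.* s) (sym diff) (sym (ℤ.pos-* c u)) ⟩
      + u ℤ.* (+ z ℤ.+ + u ℤ.* + w) ℤ.+ + (c * u) ℤ.* s
        ≡⟨ cong (λ x → + u ℤ.* x ℤ.+ + (c * u) ℤ.* s) totalℤ ⟩
      + u ℤ.* (+ (c * u) ℤ.* + Π) ℤ.+ + (c * u) ℤ.* s
        ≡⟨ factor (+ u) (+ (c * u)) s (+ Π) ⟩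
      + (c * u) ℤ.* (s ℤ.+ + Π ℤ.* + u) ∎
      where
      split : ∀ u w s c → (+ 1 ℤ.+ u) ℤ.* u ℤ.* w ≡
        u ℤ.* ((w ℤ.+ -1ℤ ℤ.* s ℤ.* c) ℤ.+ u ℤ.* w) ℤ.+ (c ℤ.* u) ℤ.* s
      split = ℤ-Solver.solve-∀
      factor : ∀ u a s Π → u ℤ.* (a ℤ.* Π) ℤ.+ a ℤ.* s ≡ a ℤ.* (s ℤ.+ Π ℤ.* u)
      factor = ℤ-Solver.solve-∀

open Arithmetic

-- Matrices over a finite field

module FiniteField {c ℓ₁ ℓ₂} (k : HeytingField c ℓ₁ ℓ₂) {q : ℕ} (1<q : 1 ℕ.< q)
  (k≅q : HasCardinality (OverField.setoid k) q) where

  R : CommutativeRing c ℓ₁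
  R = ringOf k

  open CommutativeRing R hiding (zero)
  open Matrices R
  open MatrixAlgebra R
  open RingProperties ring
  open HeytingField k using (_#_; #⇒invertible; tight)
  open Inverse k≅q using (to; from; to-cong; strictlyInverseˡ; strictlyInverseʳ)

  infix 4 _≈?_
  _≈?_ : ∀ x y → Dec (x ≈ y)
  _≈?_ = decEq k≅q

  -- Searching the finite field for an inverse decides apartness from zero.
  leftInverse : ∀ x → ¬ x ≈ 0# → ∃[ y ] y * x ≈ 1#
  leftInverse x x≉0 with Fin.any? (λ i → from i * x ≈? 1#)
  ... | yes (i , yx≈1) = from i , yx≈1
  ... | no ∄inverse = contradiction (proj₁ (tight x 0#) ¬x#0) x≉0
    where
    ¬x#0 : ¬ x # 0#
    ¬x#0 x#0 with y , y[x-0]≈1 , _ ← #⇒invertible x#0 = ∄inverse (to y , (begin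
      from (to y) * x  ≈⟨ *-congʳ (strictlyInverseʳ y) ⟩
      y * x            ≈⟨ *-congˡ (trans (+-congˡ -0#≈0#) (+-identityʳ x)) ⟨
      y * (x - 0#)     ≈⟨ y[x-0]≈1 ⟩
      1#               ∎))
      where
      open SetoidReasoning setoid

  -- A ring with 1 = 0 has a single element, which contradicts `1<q`.
  1≉0 : ¬ 1# ≈ 0#
  1≉0 1≈0 = ℕ.<⇒≢ 1<q (HasCardinality-unique (singleton-card 0# 0≈) k≅q)
    where
    0≈ : ∀ x → 0# ≈ x
    0≈ x = trans (sym (zeroˡ x)) (trans (*-congʳ (sym 1≈0)) (*-identityˡ x))

  leftInvertible⇒≉0 : ∀ {x y} → y * x ≈ 1# → ¬ x ≈ 0#
  leftInvertible⇒≉0 yx≈1 x≈0 = 1≉0 (trans (sym yx≈1) (trans (*-congˡ x≈0) (zeroʳ _)))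

  -- The row has the inverse of the first nonzero entry of `v` at that position and zeros elsewhere.
  functional : ∀ {n} (v : Vector Carrier n) → ¬ (∀ i → v i ≈ 0#) → ∃[ f ] f ∙ v ≈ 1#
  functional {zero} v v≉0 = contradiction (λ ()) v≉0
  functional {suc n} v v≉0 with head v ≈? 0#
  ... | no v₀≉0 with y , yv₀≈1 ← leftInverse _ v₀≉0 =
    y ∷ (λ _ → 0#) , trans (+-cong yv₀≈1 (∙-zeroˡ (tail v))) (+-identityʳ 1#)
  ... | yes v₀≈0 with f , fv≈1 ← functional (tail v) (λ v≈0 → v≉0 λ { zero → v₀≈0 ; (suc i) → v≈0 i }) =
    0# ∷ f , trans (+-cong (zeroˡ _) fv≈1) (+-identityˡ 1#)

  1+[q∸1]≡q : 1 ℕ.+ (q ∸ 1) ≡ q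
  1+[q∸1]≡q = ℕ.m+[n∸m]≡n (ℕ.<⇒≤ 1<q)

  units-card : HasCardinality (setoid ∣ (λ x → ¬ x ≈ 0#)) (q ∸ 1)
  units-card with complement-card {S = setoid} (_≈? 0#) (λ x≈y x≈0 → trans (sym x≈y) x≈0) k≅q
    (singleton-card {S = setoid ∣ (_≈ 0#)} (0# , refl) (λ (_ , x≈0) → sym x≈0))
  -- Matching on `1 + u ≡ q` lets `q ∸ 1` reduce to `u`.
  ... | u , ≡.refl , units≅u = units≅u

  vectors : ℕ → Setoid c ℓ₁
  vectors = VectorEquality.≋-setoid setoid

  IsZero : ∀ {n} → Vector Carrier n → Set ℓ₁
  IsZero v = ∀ i → v i ≈ 0#

  isZero? : ∀ {n} (v : Vector Carrier n) → Dec (IsZero v)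
  isZero? v = Fin.all? (λ i → v i ≈? 0#)

  nonzeroVectors-card : ∀ n → ∃[ V ] 1 ℕ.+ V ≡ q ^ n × HasCardinality (vectors n ∣ (λ v → ¬ IsZero v)) V
  nonzeroVectors-card n = complement-card {S = vectors n} isZero?
    (λ v≋w v≋0 i → trans (sym (v≋w i)) (v≋0 i)) (vector-card k≅q n)
    (singleton-card {S = vectors n ∣ IsZero} ((λ _ → 0#) , λ _ → refl) (λ (_ , v≋0) i → sym (v≋0 i)))

  GL : ℕ → Setoid _ ℓ₁
  GL n = matrixSetoid n ∣ IsInvertible

  private
    module M {n : ℕ} = Setoid (matrixSetoid n)

  trace : ∀ {n} → Setoid.Carrier (GL n) → Carrier
  trace (X , _) = tr X

  trace≈-card : ∀ {n β N} → HasCardinality (GLWithTrace n β) N →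
    HasCardinality (GL n ∣ (λ X → trace X ≈ β)) N
  trace≈-card β≅N = strictInverse
    (λ ((X , X-inv) , trX≈β) → X , X-inv , trX≈β) (λ (X , X-inv , trX≈β) → (X , X-inv) , trX≈β)
    (λ X≋Y → X≋Y) (λ X≋Y → X≋Y) (λ _ → M.refl) (λ _ → M.refl) ⨾ β≅N

  trace≈-resp : ∀ {n β} {X Y : Setoid.Carrier (GL n)} → proj₁ X ≋ proj₁ Y → trace X ≈ β → trace Y ≈ β
  trace≈-resp X≋Y trX≈β = trans (sym (tr-cong X≋Y)) trX≈β

  -- The matrices of nonzero trace are fibered by the trace over the q - 1 nonzero scalars, with
  -- fibers of the common size `w`.
  GL-card : ∀ {n z w} → HasCardinality (GLWithTrace n 0#) z →
    (∀ {β} → ¬ β ≈ 0# → HasCardinality (GLWithTrace n β) w) →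
    HasCardinality (GL n) (z ℕ.+ (q ∸ 1) ℕ.* w)
  GL-card {n} 0≅z β≅w = card-⊎ {S = GL n} (λ X → trace X ≈? 0#) (λ {X} {Y} → trace≈-resp {X = X} {Y})
    (trace≈-card 0≅z)
    (card-fibration {B = setoid ∣ (λ x → ¬ x ≈ 0#)} (λ (X , trX≉0) → trace X , trX≉0) tr-cong units-card
      λ (β , β≉0) → strictInverse
        (λ (((X , X-inv) , _) , trX≈β) → X , X-inv , trX≈β)
        (λ (X , X-inv , trX≈β) → ((X , X-inv) , λ trX≈0 → β≉0 (trans (sym trX≈β) trX≈0)) , trX≈β)
        (λ X≋Y → X≋Y) (λ X≋Y → X≋Y) (λ _ → M.refl) (λ _ → M.refl)
      ⨾ β≅w β≉0)

  -- The recursion in the size of the matrices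

  module _ {n G N : ℕ} {β : Carrier}
           (GL≅G : HasCardinality (GL n) G) (β≅N : HasCardinality (GLWithTrace n β) N) where
    private
      S = GLWithTrace (suc n) β

      col : Setoid.Carrier S → Vector Carrier n
      col (X , _) = column X

    x≈[x+y]-y : ∀ {x y z} → x + y ≈ z → x ≈ z - y
    x≈[x+y]-y {x} {y} x+y≈z = begin
      x            ≈⟨ +-identityʳ x ⟨
      x + 0#       ≈⟨ +-congˡ (-‿inverseʳ y) ⟨
      x + (y - y)  ≈⟨ +-assoc x y (- y) ⟨
      x + y - y    ≈⟨ +-congʳ x+y≈z ⟩
      _            ∎
      where
      open SetoidReasoning setoid

    [x-y]+y≈x : ∀ x y → x - y + y ≈ x
    [x-y]+y≈x x y = trans (+-assoc x (- y) y) (trans (+-congˡ (-‿inverseˡ y)) (+-identityʳ x))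

    zeroColumn-inverse : Inverse (S ∣ (IsZero ∘ col)) (vectors n ×ₛ (GL n ∣ (λ X → ¬ trace X ≈ β)))
    zeroColumn-inverse = strictInverse f g
      (λ X≋Y → (λ j → X≋Y zero (suc j)) , (λ i j → X≋Y (suc i) (suc j)))
      (λ (r≋r′ , A≋A′) → ≋-block (+-congˡ (-‿cong (tr-cong A≋A′))) r≋r′ (λ _ → refl) A≋A′)
      (λ _ → (λ _ → refl) , M.refl)
      (λ ((X , _ , trX≈β) , c≈0) → M.sym (≋-block (x≈[x+y]-y trX≈β) (λ _ → refl) c≈0 M.refl))
      where
      f : Setoid.Carrier (S ∣ (IsZero ∘ col)) → Setoid.Carrier (vectors n ×ₛ (GL n ∣ (λ X → ¬ trace X ≈ β)))
      f ((X , X-inv , trX≈β) , c≈0)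
        with y , yx≈1 , A-inv ← upperTriangular-invertible⁻¹ {r = row X}
               (invertible-resp {x = X} (≋-block refl (λ _ → refl) c≈0 M.refl) X-inv)
        -- The corner is β - tr A by the trace condition; it would vanish if tr A = β, but it has a
        -- left inverse.
        = row X , (minor X , A-inv) , λ trA≈β → leftInvertible⇒≉0 yx≈1
            (trans (x≈[x+y]-y trX≈β) (trans (+-congˡ (-‿cong trA≈β)) (-‿inverseʳ β)))

      g : Setoid.Carrier (vectors n ×ₛ (GL n ∣ (λ X → ¬ trace X ≈ β))) → Setoid.Carrier (S ∣ (IsZero ∘ col))
      g (r , (A , A-inv) , trA≉β) =
        (block (β - tr A) r (λ _ → 0#) A ,
         upperTriangular-invertible (proj₂ (leftInverse _ β-trA≉0)) r A-inv ,
         [x-y]+y≈x β (tr A)) ,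
        λ _ → refl
        where
        β-trA≉0 : ¬ β - tr A ≈ 0#
        β-trA≉0 β-trA≈0 = trA≉β (trans (sym (+-identityˡ _)) (trans (+-congʳ (sym β-trA≈0)) ([x-y]+y≈x β (tr A))))

    -- The lower right block of `assemble x s A` does not involve `x`, so the trace condition is
    -- solved for `x` with `0#` as a placeholder in `corner`; `s` and the invertible `A` stay free.
    fixedColumn-inverse : ∀ {c f : Vector Carrier n} → f ∙ c ≈ 1# →
      Inverse (S ∣ (λ X → ∀ i → col X i ≈ c i)) (vectors n ×ₛ GL n)
    fixedColumn-inverse {c} {f} f∙c≈1 = strictInverse
      (λ ((X , X-inv , _) , X₀≈c) → extractRow f∙c≈1 X , extract f∙c≈1 X ,
        assemble-invertible⁻¹ f∙c≈1 (X zero zero) (extractRow f∙c≈1 X)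
          (invertible-resp (assemble-extract f∙c≈1 X X₀≈c) X-inv))
      (λ (s , A , A-inv) → (assemble f∙c≈1 (corner s A) s A ,
        assemble-invertible f∙c≈1 (corner s A) s A-inv , [x-y]+y≈x β _) , λ _ → refl)
      (λ {((X , _) , _)} {((Y , _) , _)} X≋Y →
        extractRow-cong f∙c≈1 {X} {Y} X≋Y , extract-cong f∙c≈1 {X} {Y} X≋Y)
      (λ {(s , A , _)} {(t , B , _)} (s≋t , A≋B) → assemble-cong f∙c≈1 (corner-cong {s} {t} {A} {B} s≋t A≋B) s≋t A≋B)
      (λ (s , A , _) → extractRow-assemble f∙c≈1 (corner s A) s A , extract-assemble f∙c≈1 (corner s A) s A)
      (λ ((X , _ , trX≈β) , X₀≈c) → M.sym (M.trans (assemble-extract f∙c≈1 X X₀≈c)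
        (assemble-cong f∙c≈1 (x≈[x+y]-y (trans (+-congˡ (tr-cong
          (λ i j → sym (assemble-extract f∙c≈1 X X₀≈c (suc i) (suc j))))) trX≈β))
          (λ _ → refl) M.refl)))
      where
      -- The top left entry is the one that the trace condition leaves no choice for.
      corner : Vector Carrier n → SquareMatrix n → Carrier
      corner s A = β - tr (minor (assemble f∙c≈1 0# s A))

      corner-cong : ∀ {s t A B} → (∀ j → s j ≈ t j) → A ≋ B → corner s A ≈ corner t B
      corner-cong s≋t A≋B = +-congˡ (-‿cong (tr-cong
        (λ i j → assemble-cong f∙c≈1 {0#} refl s≋t A≋B (suc i) (suc j))))

    -- With Q = q ^ n and M = G - N, the zero column contributes Q M and each of the Q - 1 nonzero
    -- columns contributes Q G. Adding Q N completes Q M to Q G, giving Q² G without subtraction.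
    GLWithTrace-suc-card : ∃[ N′ ] HasCardinality (GLWithTrace (suc n) β) N′ ×
      N′ ℕ.+ q ^ n ℕ.* N ≡ q ^ n ℕ.* q ^ n ℕ.* G
    GLWithTrace-suc-card
      with M , N+M≡G , ≉β≅M ← complement-card {S = GL n} (λ X → trace X ≈? β)
             (λ {X} {Y} → trace≈-resp {X = X} {Y}) GL≅G (trace≈-card β≅N)
         | V , 1+V≡qⁿ , units≅V ← nonzeroVectors-card n
      = q ^ n ℕ.* M ℕ.+ V ℕ.* (q ^ n ℕ.* G) ,
        card-⊎ {S = S} (isZero? ∘ col)
          (λ X≋Y c≈0 i → trans (sym (X≋Y (suc i) zero)) (c≈0 i))
          (zeroColumn-inverse ⨾ card-× (vector-card k≅q n) ≉β≅M)
          (card-fibration {B = vectors n ∣ (λ v → ¬ IsZero v)}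
            (λ (X , c≉0) → col X , c≉0) (λ X≋Y i → X≋Y (suc i) zero) units≅V nonzeroColumn) ,
        (begin
          q ^ n ℕ.* M ℕ.+ V ℕ.* (q ^ n ℕ.* G) ℕ.+ q ^ n ℕ.* N  ≡⟨ regroup (q ^ n) M V G N ⟩
          q ^ n ℕ.* (N ℕ.+ M) ℕ.+ V ℕ.* (q ^ n ℕ.* G)          ≡⟨ ≡.cong (λ x → q ^ n ℕ.* x ℕ.+ V ℕ.* (q ^ n ℕ.* G)) N+M≡G ⟩
          (1 ℕ.+ V) ℕ.* (q ^ n ℕ.* G)                          ≡⟨ ≡.cong (ℕ._* (q ^ n ℕ.* G)) 1+V≡qⁿ ⟩
          q ^ n ℕ.* (q ^ n ℕ.* G)                              ≡⟨ ℕ.*-assoc (q ^ n) (q ^ n) G ⟨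
          q ^ n ℕ.* q ^ n ℕ.* G                                ∎)
      where
      open ≡.≡-Reasoning

      regroup : ∀ Q M V G N → Q ℕ.* M ℕ.+ V ℕ.* (Q ℕ.* G) ℕ.+ Q ℕ.* N ≡ Q ℕ.* (N ℕ.+ M) ℕ.+ V ℕ.* (Q ℕ.* G)
      regroup = ℕ-Solver.solve-∀

      -- Over a nonzero `c` the column is automatically nonzero, so the fiber is the set treated by
      -- `fixedColumn-inverse`.
      nonzeroColumn : ((c , c≉0) : Setoid.Carrier (vectors n ∣ (λ v → ¬ IsZero v))) →
        HasCardinality (S ∣ (¬_ ∘ IsZero ∘ col) ∣ (λ (X , _) → ∀ i → col X i ≈ c i)) (q ^ n ℕ.* G)
      nonzeroColumn (c , c≉0) = strictInverse
        {B = S ∣ (λ X → ∀ i → col X i ≈ c i)}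
        (λ ((X , _) , X₀≈c) → X , X₀≈c)
        (λ (X , X₀≈c) → (X , λ X₀≈0 → c≉0 (λ i → trans (sym (X₀≈c i)) (X₀≈0 i))) , X₀≈c)
        (λ X≋Y → X≋Y) (λ X≋Y → X≋Y) (λ _ → M.refl) (λ _ → M.refl)
        ⨾ fixedColumn-inverse (proj₂ (functional c c≉0)) ⨾ card-× (vector-card k≅q n) GL≅G

  -- Induction on the size

  record TraceCounts (n : ℕ) : Set (c ⊔ ℓ₁) where
    field
      z w : ℕ
      zeroTrace-card : HasCardinality (GLWithTrace n 0#) z
      nonzeroTrace-card : ∀ {β} → ¬ β ≈ 0# → HasCardinality (GLWithTrace n β) w
      -- The right side is the order of GLₙ, with the factors q - 1 up to qⁿ - 1.
      total : z ℕ.+ (q ∸ 1) ℕ.* w ≡ q ^ (n C 2) ℕ.* product (applyUpTo (λ j → q ^ suc j ∸ 1) n)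
      difference : + z ≡ + w ℤ.+ -1ℤ ^ℤ n ℤ.* + (q ^ (n C 2))

  traceCounts : ∀ n → TraceCounts n
  traceCounts zero = record
    -- The empty matrix is its own inverse and has trace 0.
    { z = 1
    ; w = 0
    ; zeroTrace-card = singleton-card ((λ ()) , ((λ ()) , (λ ()) , (λ ())) , refl) (λ _ ())
    ; nonzeroTrace-card = λ β≉0 → empty-card (λ (_ , _ , 0≈β) → β≉0 (sym 0≈β))
    ; total = ≡.cong suc (ℕ.*-zeroʳ (q ∸ 1))
    ; difference = ≡.refl
    }
  traceCounts (suc n) = record
    { z = proj₁ z′
    -- Trace 1 represents all nonzero traces.
    ; w = proj₁ (w′ 1≉0)
    ; zeroTrace-card = proj₁ (proj₂ z′)
    ; nonzeroTrace-card = λ β≉0 → ≡.subst (HasCardinality _) (w′-unique β≉0) (proj₁ (proj₂ (w′ β≉0)))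
    ; total = begin
        proj₁ z′ ℕ.+ (q ∸ 1) ℕ.* proj₁ (w′ 1≉0)
          ≡⟨ total-step (q ∸ 1) (q ^ n) (q ^ suc n ∸ 1) total z′-eq (w′-eq 1≉0) 1+r≡ ⟩
        q ^ n ℕ.* (q ^ (n C 2) ℕ.* Π) ℕ.* (q ^ suc n ∸ 1)
          ≡⟨ regroup (q ^ n) (q ^ (n C 2)) Π (q ^ suc n ∸ 1) ⟩
        q ^ n ℕ.* q ^ (n C 2) ℕ.* (Π ℕ.* (q ^ suc n ∸ 1))
          ≡⟨ ≡.cong₂ ℕ._*_ (^-[1+m]C2 q n) (product-applyUpTo-suc (λ j → q ^ suc j ∸ 1) n) ⟨
        q ^ (suc n C 2) ℕ.* product (applyUpTo (λ j → q ^ suc j ∸ 1) (suc n)) ∎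
    ; difference = begin
        + proj₁ z′
          ≡⟨ difference-step (q ^ n) D difference (≡.trans z′-eq (≡.sym (w′-eq 1≉0))) ⟩
        + proj₁ (w′ 1≉0) ℤ.+ -1ℤ ℤ.* (+ (q ^ n) ℤ.* D)
          ≡⟨ ≡.cong (λ x → + proj₁ (w′ 1≉0) ℤ.+ x) D′≡ ⟩
        + proj₁ (w′ 1≉0) ℤ.+ -1ℤ ^ℤ suc n ℤ.* + (q ^ (suc n C 2)) ∎
    }
    where
    open TraceCounts (traceCounts n)
    open ≡.≡-Reasoning

    GL≅ : HasCardinality (GL n) (q ^ (n C 2) ℕ.* product (applyUpTo (λ j → q ^ suc j ∸ 1) n))
    GL≅ = ≡.subst (HasCardinality (GL n)) total (GL-card zeroTrace-card nonzeroTrace-card)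
    z′ = GLWithTrace-suc-card GL≅ zeroTrace-card

    w′ : ∀ {β} → ¬ β ≈ 0# → _
    w′ β≉0 = GLWithTrace-suc-card GL≅ (nonzeroTrace-card β≉0)

    Π = product (applyUpTo (λ j → q ^ suc j ∸ 1) n)
    D = -1ℤ ^ℤ n ℤ.* + (q ^ (n C 2))

    z′-eq = proj₂ (proj₂ z′)

    w′-eq : ∀ {β} (β≉0 : ¬ β ≈ 0#) → _
    w′-eq β≉0 = proj₂ (proj₂ (w′ β≉0))

    -- The recursion determines the new count from `w` and the order of GLₙ, neither of which
    -- depends on β.
    w′-unique : ∀ {β} (β≉0 : ¬ β ≈ 0#) → proj₁ (w′ β≉0) ≡ proj₁ (w′ 1≉0)
    w′-unique β≉0 = ℕ.+-cancelʳ-≡ _ _ _ (≡.trans (w′-eq β≉0) (≡.sym (w′-eq 1≉0)))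

    1+r≡ : 1 ℕ.+ (q ^ suc n ∸ 1) ≡ (1 ℕ.+ (q ∸ 1)) ℕ.* q ^ n
    1+r≡ = ≡.trans (ℕ.m+[n∸m]≡n (ℕ.m^n>0 q {{>-nonZero (ℕ.<⇒≤ 1<q)}} (suc n)))
      (≡.cong (ℕ._* q ^ n) (≡.sym 1+[q∸1]≡q))

    regroup : ∀ Q c Π r → Q ℕ.* (c ℕ.* Π) ℕ.* r ≡ Q ℕ.* c ℕ.* (Π ℕ.* r)
    regroup = ℕ-Solver.solve-∀

    D′≡ : -1ℤ ℤ.* (+ (q ^ n) ℤ.* D) ≡ -1ℤ ^ℤ suc n ℤ.* + (q ^ (suc n C 2))
    D′≡ = begin
      -1ℤ ℤ.* (+ (q ^ n) ℤ.* (-1ℤ ^ℤ n ℤ.* + (q ^ (n C 2))))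
        ≡⟨ commute (+ (q ^ n)) (-1ℤ ^ℤ n) (+ (q ^ (n C 2))) ⟩
      -1ℤ ^ℤ suc n ℤ.* (+ (q ^ n) ℤ.* + (q ^ (n C 2)))
        ≡⟨ ≡.cong (-1ℤ ^ℤ suc n ℤ.*_) (ℤ.pos-* (q ^ n) (q ^ (n C 2))) ⟨
      -1ℤ ^ℤ suc n ℤ.* + (q ^ n ℕ.* q ^ (n C 2))
        ≡⟨ ≡.cong (λ x → -1ℤ ^ℤ suc n ℤ.* + x) (^-[1+m]C2 q n) ⟨
      -1ℤ ^ℤ suc n ℤ.* + (q ^ (suc n C 2)) ∎
      where
      commute : ∀ Q s c → -1ℤ ℤ.* (Q ℤ.* (s ℤ.* c)) ≡ -1ℤ ℤ.* s ℤ.* (Q ℤ.* c)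
      commute = ℤ-Solver.solve-∀

-- The closed formulas over the rationals

open import Data.Rational.Base using (_/_; _+_; _*_)

theorem3p1 : ∀ {c ℓ₁ ℓ₂} (q : ℕ) (q-primePower : IsPrimePower q)
    (k : HeytingField c ℓ₁ ℓ₂) →
    let open OverField k in
    let open Denominators q-primePower in
    HasCardinality setoid q →
    (n : ℕ) → n ≥ 1 →
    (h : Carrier) → ¬ (h ≈ 0#) →
    (∃[ N₀ ] HasCardinality (GLWithTrace n 0#) N₀ ×
    (+ N₀) / 1 ≡
    ((+ (q ^ (n C 2) *ℕ (q ∸ 1))) / q) *
    ((-1ℤ ^ℤ n) / 1 + (+ (∏[ i from 2 to n ] (q ^ i ∸ 1))) / 1))
    ×
    (∃[ Nₕ ] HasCardinality (GLWithTrace n h) Nₕ ×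
    (+ Nₕ) / 1 ≡
    ((+ (q ^ (n C 2) *ℕ (q ∸ 1))) / q) *
    ((-1ℤ ^ℤ (n ∸ 1)) / (q ∸ 1) + (+ (∏[ i from 2 to n ] (q ^ i ∸ 1))) / 1))
theorem3p1 q pp k k≅q (suc m) _ h h≉0 =
  (z , zeroTrace-card , clear-denominators (+ z) (+ (q ^ (suc m C 2) *ℕ u)) (-1ℤ ^ℤ suc m) (+ Π) q 1 (≡.subst
    (λ x → + x ℤ.* + 1 ℤ.* + z ≡ + (q ^ (suc m C 2) *ℕ u) ℤ.* (-1ℤ ^ℤ suc m ℤ.+ + Π ℤ.* + 1)) 1+[q∸1]≡q
    (solve-z u (q ^ (suc m C 2)) Π z w (-1ℤ ^ℤ suc m) total′ difference))) ,
  -- The power with exponent `suc m` unfolds to -1 times the power with exponent `m`, so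
  -- `difference` has the form that `solve-w` expects.
  (w , nonzeroTrace-card h≉0 , clear-denominators (+ w) (+ (q ^ (suc m C 2) *ℕ u)) (-1ℤ ^ℤ m) (+ Π) q u (≡.subst
    (λ x → + x ℤ.* + u ℤ.* + w ≡ + (q ^ (suc m C 2) *ℕ u) ℤ.* (-1ℤ ^ℤ m ℤ.+ + Π ℤ.* + u)) 1+[q∸1]≡q
    (solve-w u (q ^ (suc m C 2)) Π z w (-1ℤ ^ℤ m) total′ difference)))
  where
  open FiniteField k (primePower>1 pp) k≅q
  open Denominators pp
  open TraceCounts (traceCounts (suc m))
  u = q ∸ 1
  Π = ∏[ i from 2 to suc m ] (q ^ i ∸ 1)
  total′ : z ℕ.+ u *ℕ w ≡ q ^ (suc m C 2) *ℕ (u *ℕ Π)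
  -- The product in `total` unfolds to its first factor `q ^ 1 ∸ 1`, which is `u`, times the product
  -- from 2.
  total′ = ≡.trans total (≡.cong (λ x → q ^ (suc m C 2) *ℕ ((x ∸ 1) *ℕ Π)) (ℕ.^-identityʳ q))
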